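{- For integers $m\ge 0$ and $r\ge 1$, let $a_{mr}$ denote the number of stable rooted ribbon trees $T$ with $r$ leaves and $d(T)=m$, and let $$f(t,x)\coloneqq\sum_{m\ge 0,\ r\ge 1} a_{mr}\,t^m x^r\in\mathbb{Q}[[t,x]].$$ Then $f$ satisfies $$f=\frac{f^2}{1-tf}+x,\qquad \frac{\partial f}{\partial x}(0,0)=1,$$ and $f$ is the unique formal power series in $\mathbb{Q}[[t,x]]$ satisfying these two equations.
   Context: A rooted ribbon tree (RRT) is a finite rooted tree together with a planar structure, i.e. a linear ordering of the children of each vertex; trees are considered up to isomorphism preserving the root and these orderings. A leaf is a vertex with no children (when the tree consists of a single vertex, that vertex is its unique leaf), and an internal vertex is a vertex which is not a leaf. An RRT is stable if every internal vertex has at least $2$ children. For a stable RRT $T$ with $r$ leaves and set of internal vertices $T_{\mathrm{int}}$, its dimension is $d(T)\coloneqq r-\#T_{\mathrm{int}}-1$. (The stable RRTs with $r$ leaves are the faces of the associahedron $K_r$, and $d(T)$ is the dimension of the corresponding face; e.g. for $r=4$ there are $5$ trees of dimension $0$, $5$ of dimension $1$ and $1$ of dimension $2$.) Note that in $\mathbb{Q}[[t,x]]$ the element $1-tg$ is invertible for every $g$, so the equation makes sense for every formal power series. -}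

module Defs where

open import Data.Nat using (ℕ; zero; suc; _∸_; _≤_)
open import Data.Integer using (ℤ; +_; _-_)
open import Data.List using (List; []; _∷_; length)
open import Data.Product using (Σ; _×_)
open import Data.Unit using (⊤)
open import Data.Rational using (ℚ; 0ℚ; 1ℚ; _+_; _*_)
import Data.Rational as Q
open import Relation.Binary.PropositionalEquality using (_≡_)

-- Rooted ribbon trees.  A vertex is given by the *ordered* list of its
-- children, so syntactic equality of 'Tree's is exactly isomorphism
-- preserving the root and the orderings of children.

data Tree : Set where
  node : List Tree → Tree

mutual
  leaves : Tree → ℕ
  leaves (node [])         = 1
  leaves (node (c ∷ cs))   = leavesL (c ∷ cs)

  leavesL : List Tree → ℕ
  leavesL []       = 0
  leavesL (c ∷ cs) = leaves c Data.Nat.+ leavesL cs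

mutual
  internal : Tree → ℕ
  internal (node [])       = 0
  internal (node (c ∷ cs)) = suc (internalL (c ∷ cs))

  internalL : List Tree → ℕ
  internalL []       = 0
  internalL (c ∷ cs) = internal c Data.Nat.+ internalL cs

mutual
  Stable : Tree → Set
  Stable (node [])         = ⊤
  Stable (node (c ∷ cs))   = (2 ≤ length (c ∷ cs)) × StableL (c ∷ cs)

  StableL : List Tree → Set
  StableL []       = ⊤
  StableL (c ∷ cs) = Stable c × StableL cs

dim : Tree → ℤ
dim T = (+ leaves T) - (+ internal T) - (+ 1)

StableRRT : ℕ → ℕ → Set
StableRRT m r = Σ Tree (λ T → Stable T × (leaves T ≡ r) × (dim T ≡ + m))

-- Formal power series in ℚ[[t,x]]: F m r is the coefficient of t^m x^r.

PS : Set
PS = ℕ → ℕ → ℚ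

_≈_ : PS → PS → Set
F ≈ G = ∀ m r → F m r ≡ G m r

ℕtoℚ : ℕ → ℚ
ℕtoℚ n = (+ n) Q./ 1

sumTo : ℕ → (ℕ → ℚ) → ℚ
sumTo zero    h = h zero
sumTo (suc n) h = sumTo n h + h (suc n)

δ : ℕ → ℕ → ℚ
δ zero    zero    = 1ℚ
δ zero    (suc _) = 0ℚ
δ (suc _) zero    = 0ℚ
δ (suc m) (suc n) = δ m n

oneS : PS
oneS m r = δ m 0 * δ r 0

tS : PS
tS m r = δ m 1 * δ r 0

xS : PS
xS m r = δ m 0 * δ r 1

_⊕_ : PS → PS → PS
(F ⊕ G) m r = F m r + G m r

_⊗_ : PS → PS → PS
(F ⊗ G) m r = sumTo m (λ i → sumTo r (λ j → F i j * G (m ∸ i) (r ∸ j)))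

_^S_ : PS → ℕ → PS
F ^S zero  = oneS
F ^S suc k = F ⊗ (F ^S k)

-- geom U = Σ_{k≥0} U^k = (1 - U)⁻¹, for U with zero constant term
-- (then only k ≤ m + r contribute to the coefficient of t^m x^r).
geom : PS → PS
geom U m r = sumTo (m Data.Nat.+ r) (λ k → (U ^S k) m r)

inv1mt : PS → PS
inv1mt G = geom (tS ⊗ G)

∂x : PS → PS
∂x F m r = ℕtoℚ (suc r) * F m (suc r)

SatisfiesEqs : PS → Set
SatisfiesEqs F = (F ≈ (((F ⊗ F) ⊗ inv1mt F) ⊕ xS)) × (∂x F 0 0 ≡ 1ℚ)

genFun : (ℕ → ℕ → ℕ) → PS
genFun a m zero    = 0ℚ
genFun a m (suc r) = ℕtoℚ (a m (suc r))

module Submission where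

-- The t⁰x¹-coefficient of the
-- equation reads f₀₁ = 2 f₀₀ f₀₁ + 1, so f₀₁ = 1 forces f₀₀ = 0; then an
-- induction on m shows that f has no x⁰-terms at all.  For such f the
-- coefficients of x^(R+1) in f²/(1 - tf) only involve coefficients of x^r,
-- r ≤ R, of f, so two solutions agree by induction on the power of x.
--
-- A
-- weighted type (elements carrying a t- and an x-degree) is counted by a
-- series; disjoint unions, products and sequences are counted by ⊕, ⊗ and
-- the geometric series.  Cutting a stable tree at its root identifies it
-- with either a leaf (x) or two subtrees followed by a sequence of further
-- subtrees each raising the dimension by one (t · tree), which is counted by
-- f²/(1 - tf) + x.  Counting both sides gives the equation; the derivative
-- condition is again the t⁰x¹-coefficient, now with f₀₀ = 0.

open import Defs
open import Data.Nat using (ℕ; _≤_)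
open import Data.Fin using (Fin)
open import Data.Product using (_×_; _,_)
open import Function.Bundles using (_↔_)

module PowerSeries where

  open import Data.Nat using (zero; suc; _∸_; z≤n)
  open import Data.Nat.Properties using (≤-refl; m≤n⇒m≤1+n)
  open import Data.Rational using (ℚ; 0ℚ; 1ℚ; _+_; _*_)
  open import Data.Rational.Properties using (+-identityˡ; *-identityʳ; *-zeroˡ; *-zeroʳ)
  open import Relation.Binary.PropositionalEquality

  sumTo-cong : ∀ n {h h′ : ℕ → ℚ} → (∀ i → i ≤ n → h i ≡ h′ i) → sumTo n h ≡ sumTo n h′
  sumTo-cong zero    e = e 0 z≤n
  sumTo-cong (suc n) e = cong₂ _+_ (sumTo-cong n (λ i i≤n → e i (m≤n⇒m≤1+n i≤n))) (e (suc n) ≤-refl)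

  sumTo-zero : ∀ n {h : ℕ → ℚ} → (∀ i → i ≤ n → h i ≡ 0ℚ) → sumTo n h ≡ 0ℚ
  sumTo-zero n e = trans (sumTo-cong n e) (sum-of-zeros n)
    where
    sum-of-zeros : ∀ n → sumTo n (λ _ → 0ℚ) ≡ 0ℚ
    sum-of-zeros zero    = refl
    sum-of-zeros (suc n) = trans (cong (_+ 0ℚ) (sum-of-zeros n)) refl

  zero-*ˡ : ∀ {p} q → p ≡ 0ℚ → p * q ≡ 0ℚ
  zero-*ˡ q refl = *-zeroˡ q

  zero-*ʳ : ∀ p {q} → q ≡ 0ℚ → p * q ≡ 0ℚ
  zero-*ʳ p refl = *-zeroʳ p

  ⊗-coeff-cong : ∀ (A B A′ B′ : PS) m r
    → (∀ i j → i ≤ m → j ≤ r → A i j * B (m ∸ i) (r ∸ j) ≡ A′ i j * B′ (m ∸ i) (r ∸ j))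
    → (A ⊗ B) m r ≡ (A′ ⊗ B′) m r
  ⊗-coeff-cong _ _ _ _ m r e = sumTo-cong m (λ i i≤m → sumTo-cong r (λ j j≤r → e i j i≤m j≤r))

  Φ : PS → PS
  Φ F = ((F ⊗ F) ⊗ inv1mt F) ⊕ xS

  ⊗-t⁰ : ∀ {A} B r → (∀ j → A 0 j ≡ 0ℚ) → (A ⊗ B) 0 r ≡ 0ℚ
  ⊗-t⁰ {A} B r e = sumTo-zero r (λ j _ → zero-*ˡ (B 0 (r ∸ j)) (e j))

  inv1mt-01 : ∀ F → inv1mt F 0 1 ≡ 0ℚ
  inv1mt-01 F = cong (oneS 0 1 +_) (⊗-t⁰ {tS ⊗ F} oneS 1 (λ j → ⊗-t⁰ {tS} F j (λ k → zero-*ˡ (δ k 0) refl)))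

  equation-at-01 : ∀ F → F ≈ Φ F → F 0 1 ≡ (F 0 0 * F 0 1 + F 0 1 * F 0 0) + 1ℚ
  equation-at-01 F eq = begin
    F 0 1                                                       ≡⟨ eq 0 1 ⟩
    ((F ⊗ F) 0 0 * inv1mt F 0 1 + (F ⊗ F) 0 1 * 1ℚ) + 1ℚ       ≡⟨ cong (λ z → ((F ⊗ F) 0 0 * z + (F ⊗ F) 0 1 * 1ℚ) + 1ℚ) (inv1mt-01 F) ⟩
    ((F ⊗ F) 0 0 * 0ℚ + (F ⊗ F) 0 1 * 1ℚ) + 1ℚ                 ≡⟨ cong₂ (λ u v → (u + v) + 1ℚ) (*-zeroʳ ((F ⊗ F) 0 0)) (*-identityʳ ((F ⊗ F) 0 1)) ⟩
    (0ℚ + (F 0 0 * F 0 1 + F 0 1 * F 0 0)) + 1ℚ                ≡⟨ cong (_+ 1ℚ) (+-identityˡ ((F ⊗ F) 0 1)) ⟩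
    (F 0 0 * F 0 1 + F 0 1 * F 0 0) + 1ℚ                       ∎
    where open ≡-Reasoning

module Uniqueness where

  open PowerSeries
  open import Data.Nat using (zero; suc; _∸_; _<_; z≤n; s≤s)
  import Data.Nat as Nat
  open import Data.Nat.Properties using (≤-refl; ≤-trans; ≤-pred; m∸n≤m; n∸n≡0; ∸-monoʳ-<; m≤n⇒m<n∨m≡n)
  open import Data.Rational using (ℚ; 0ℚ; 1ℚ; ½; _+_; _*_)
  open import Data.Rational.Properties using (*-identityˡ; *-identityʳ; *-zeroʳ; *-distribˡ-+; *-distribʳ-+; +-0-group)
  open import Algebra.Properties.Group +-0-group using (identityˡ-unique)
  open import Data.Product using (_,_; proj₁)
  open import Data.Sum using (inj₁; inj₂)
  open import Relation.Binary.PropositionalEquality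

  Row0 : PS → Set
  Row0 F = ∀ m → F m 0 ≡ 0ℚ

  record Agree (R : ℕ) (F G : PS) : Set where
    constructor agreeing
    field coeff : ∀ m r → r ≤ R → F m r ≡ G m r
  open Agree

  ⊗-row0-upto : ∀ A B m → (∀ i → i ≤ m → A i 0 ≡ 0ℚ) → (A ⊗ B) m 0 ≡ 0ℚ
  ⊗-row0-upto A B m zA = sumTo-zero m (λ i i≤m → zero-*ˡ (B (m ∸ i) 0) (zA i i≤m))

  ⊗-row0 : ∀ A B → Row0 A → Row0 (A ⊗ B)
  ⊗-row0 A B zA m = ⊗-row0-upto A B m (λ i _ → zA i)

  ⊗-row0-at : ∀ (A B : PS) m → A 0 0 ≡ 0ℚ → (∀ k → k < m → B k 0 ≡ 0ℚ) → (A ⊗ B) m 0 ≡ 0ℚ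
  ⊗-row0-at A B m A₀₀ Bₖ₀ = sumTo-zero m term
    where
    term : ∀ i → i ≤ m → A i 0 * B (m ∸ i) 0 ≡ 0ℚ
    term zero    _   = zero-*ˡ (B m 0) A₀₀
    term (suc i) i<m = zero-*ʳ (A (suc i) 0) (Bₖ₀ (m ∸ suc i) (∸-monoʳ-< {m} (s≤s z≤n) i<m))

  solution-row0 : ∀ F → F ≈ Φ F → F 0 0 ≡ 0ℚ → Row0 F
  solution-row0 F eq F₀₀ m = below (suc m) m ≤-refl
    where
    below : ∀ n k → k < n → F k 0 ≡ 0ℚ
    below (suc n) k k<1+n with m≤n⇒m<n∨m≡n (≤-pred k<1+n)
    ... | inj₁ k<n  = below n k k<n
    ... | inj₂ refl = begin
      F k 0                                          ≡⟨ eq k 0 ⟩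
      ((F ⊗ F) ⊗ inv1mt F) k 0 + δ k 0 * 0ℚ          ≡⟨ cong₂ _+_ (⊗-row0-upto (F ⊗ F) (inv1mt F) k square-row0) (*-zeroʳ (δ k 0)) ⟩
      0ℚ + 0ℚ                                        ≡⟨⟩
      0ℚ                                             ∎
      where
      open ≡-Reasoning
      square-row0 : ∀ i → i ≤ k → (F ⊗ F) i 0 ≡ 0ℚ
      square-row0 i i≤k = ⊗-row0-at F F i F₀₀ (λ j j<i → below k j (≤-trans j<i i≤k))

  agree-extend : ∀ {R} {F G : PS} → Agree R F G → (∀ m → F m (suc R) ≡ G m (suc R)) → Agree (suc R) F G
  agree-extend {R} {F} {G} ag new = agreeing extended
    where
    extended : ∀ m r → r ≤ suc R → F m r ≡ G m r
    extended m r r≤1+R with m≤n⇒m<n∨m≡n r≤1+R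
    ... | inj₁ r<1+R = coeff ag m r (≤-pred r<1+R)
    ... | inj₂ refl  = new m

  -- Agreement up to x^R is a congruence for ⊗, powers and (1 - t·)⁻¹,
  -- since the coefficient of x^r in a product only involves x^j with j ≤ r.
  ⊗-agree : ∀ {R} {A B A′ B′ : PS} → Agree R A A′ → Agree R B B′ → Agree R (A ⊗ B) (A′ ⊗ B′)
  ⊗-agree {A = A} {B} {A′} {B′} a b = agreeing λ m r r≤R → ⊗-coeff-cong A B A′ B′ m r (λ i j _ j≤r →
    cong₂ _*_ (coeff a i j (≤-trans j≤r r≤R)) (coeff b (m ∸ i) (r ∸ j) (≤-trans (m∸n≤m r j) r≤R)))

  ^S-agree : ∀ {R} {U V : PS} k → Agree R U V → Agree R (U ^S k) (V ^S k)
  ^S-agree zero    _ = agreeing (λ _ _ _ → refl)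
  ^S-agree (suc k) a = ⊗-agree a (^S-agree k a)

  inv1mt-agree : ∀ {R} {F G : PS} → Agree R F G → Agree R (inv1mt F) (inv1mt G)
  inv1mt-agree a = agreeing λ m r r≤R →
    sumTo-cong (m Nat.+ r) (λ k _ → coeff (^S-agree k (⊗-agree {A = tS} (agreeing (λ _ _ _ → refl)) a)) m r r≤R)

  -- If A, A′ have no x⁰-terms and agree up to x^(R+1), and B, B′ agree up
  -- to x^R, then A ⊗ B and A′ ⊗ B′ agree at x^(R+1): each term there pairs
  -- x^j in A, j ≥ 1, with x^(R+1-j) in B.
  ⊗-agree-next : ∀ {R} {A A′ B B′ : PS} → Row0 A → Row0 A′ → Agree (suc R) A A′ → Agree R B B′
    → ∀ m → (A ⊗ B) m (suc R) ≡ (A′ ⊗ B′) m (suc R)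
  ⊗-agree-next {R} {A} {A′} {B} {B′} zA zA′ a b m = ⊗-coeff-cong A B A′ B′ m (suc R) term
    where
    term : ∀ i j → i ≤ m → j ≤ suc R → A i j * B (m ∸ i) (suc R ∸ j) ≡ A′ i j * B′ (m ∸ i) (suc R ∸ j)
    term i zero    _ _   = trans (zero-*ˡ (B (m ∸ i) (suc R)) (zA i)) (sym (zero-*ˡ (B′ (m ∸ i) (suc R)) (zA′ i)))
    term i (suc j) _ j≤R = cong₂ _*_ (coeff a i (suc j) j≤R) (coeff b (m ∸ i) (R ∸ j) (m∸n≤m R j))

  -- If all four factors have no x⁰-terms and agree pairwise up to x^R, the
  -- products agree at x^(R+1): the terms with j = 0 or j = R+1 vanish.
  ⊗-agree-next₀ : ∀ {R} {A A′ B B′ : PS} → Row0 A → Row0 A′ → Row0 B → Row0 B′ → Agree R A A′ → Agree R B B′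
    → ∀ m → (A ⊗ B) m (suc R) ≡ (A′ ⊗ B′) m (suc R)
  ⊗-agree-next₀ {R} {A} {A′} {B} {B′} zA zA′ zB zB′ a b m = ⊗-coeff-cong A B A′ B′ m (suc R) term
    where
    last : ∀ {C} (D : PS) → Row0 D → ∀ i k → C i (suc R) * D k (R ∸ R) ≡ 0ℚ
    last {C} D zD i k = zero-*ʳ (C i (suc R)) (trans (cong (D k) (n∸n≡0 R)) (zD k))

    term : ∀ i j → i ≤ m → j ≤ suc R → A i j * B (m ∸ i) (suc R ∸ j) ≡ A′ i j * B′ (m ∸ i) (suc R ∸ j)
    term i zero    _ _ = trans (zero-*ˡ (B (m ∸ i) (suc R)) (zA i)) (sym (zero-*ˡ (B′ (m ∸ i) (suc R)) (zA′ i)))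
    term i (suc j) _ (s≤s j≤R) with m≤n⇒m<n∨m≡n j≤R
    ... | inj₁ j<R  = cong₂ _*_ (coeff a i (suc j) j<R) (coeff b (m ∸ i) (R ∸ j) (m∸n≤m R j))
    ... | inj₂ refl = trans (last {A} B zB i (m ∸ i)) (sym (last {A′} B′ zB′ i (m ∸ i)))

  Φ-agree-next : ∀ {R} {F G : PS} → Row0 F → Row0 G → Agree R F G → ∀ m → Φ F m (suc R) ≡ Φ G m (suc R)
  Φ-agree-next {R} {F} {G} zF zG a m =
    cong (_+ xS m (suc R)) (⊗-agree-next (⊗-row0 F F zF) (⊗-row0 G G zG) squares-agree (inv1mt-agree a) m)
    where
    squares-agree : Agree (suc R) (F ⊗ F) (G ⊗ G)
    squares-agree = agree-extend (⊗-agree a a) (⊗-agree-next₀ zF zG zF zG a a)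

  solutions-agree : ∀ {F G : PS} → F ≈ Φ F → G ≈ Φ G → Row0 F → Row0 G → ∀ R → Agree R F G
  solutions-agree eqF eqG zF zG zero = agreeing λ { m zero z≤n → trans (zF m) (sym (zG m)) }
  solutions-agree {F} {G} eqF eqG zF zG (suc R) = agree-extend IH (λ m → begin
      F m (suc R)    ≡⟨ eqF m (suc R) ⟩
      Φ F m (suc R)  ≡⟨ Φ-agree-next zF zG IH m ⟩
      Φ G m (suc R)  ≡⟨ sym (eqG m (suc R)) ⟩
      G m (suc R)    ∎)
    where
    open ≡-Reasoning
    IH : Agree R F G
    IH = solutions-agree eqF eqG zF zG R

  solution-01 : ∀ F → SatisfiesEqs F → F 0 1 ≡ 1ℚ
  solution-01 F (_ , ∂F) = trans (sym (*-identityˡ (F 0 1))) ∂F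

  -- The constant term of a solution vanishes: equation-at-01 with F₀₁ = 1
  -- reads 1 = 2 F₀₀ + 1.
  solution-00 : ∀ F → SatisfiesEqs F → F 0 0 ≡ 0ℚ
  solution-00 F sF = begin
    x              ≡⟨ sym (*-identityˡ x) ⟩
    1ℚ * x         ≡⟨ *-distribʳ-+ x ½ ½ ⟩
    ½ * x + ½ * x  ≡⟨ sym (*-distribˡ-+ ½ x x) ⟩
    ½ * (x + x)    ≡⟨ cong (½ *_) double-x≡0 ⟩
    ½ * 0ℚ         ≡⟨ *-zeroʳ ½ ⟩
    0ℚ             ∎
    where
    open ≡-Reasoning
    x : ℚ
    x = F 0 0
    one-eq : (x + x) + 1ℚ ≡ 1ℚ
    one-eq = begin
      (x + x) + 1ℚ                      ≡⟨ cong₂ (λ u v → (u + v) + 1ℚ) (sym (*-identityʳ x)) (sym (*-identityˡ x)) ⟩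
      (x * 1ℚ + 1ℚ * x) + 1ℚ            ≡⟨ cong (λ y → (x * y + y * x) + 1ℚ) (sym (solution-01 F sF)) ⟩
      (x * F 0 1 + F 0 1 * x) + 1ℚ      ≡⟨ sym (equation-at-01 F (proj₁ sF)) ⟩
      F 0 1                             ≡⟨ solution-01 F sF ⟩
      1ℚ                                ∎
    double-x≡0 : x + x ≡ 0ℚ
    double-x≡0 = identityˡ-unique (x + x) 1ℚ one-eq

  uniqueness : ∀ F G → SatisfiesEqs F → SatisfiesEqs G → F ≈ G
  uniqueness F G sF sG m r =
    coeff (solutions-agree (proj₁ sF) (proj₁ sG) (row0 F sF) (row0 G sG) r) m r ≤-refl
    where
    row0 : ∀ H → SatisfiesEqs H → Row0 H
    row0 H sH = solution-row0 H (proj₁ sH) (solution-00 H sH)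

-- Finite types whose number of elements is a given rational number.
module FiniteSize where

  open import Data.Nat using (zero; suc; _<_; z≤n; s≤s)
  import Data.Nat as Nat
  open import Data.Nat.Properties using (≤-refl; m≤n⇒m≤1+n; m≤n⇒m<n∨m≡n; ≤-irrelevant; <-irrefl; suc-injective)
  open import Data.Nat.Coprimality using (1-coprimeTo)
  import Data.Nat.Coprimality as Coprimality
  import Data.Integer as ℤ
  open import Data.Integer using (+_)
  open import Data.Integer.Properties using (*-identityʳ; pos-+; pos-*)
  open import Data.Rational using (ℚ; mkℚ; 0ℚ; 1ℚ; _+_; _*_; _/_)
  open import Data.Rational.Properties using (normalize-coprime)
  open import Data.Fin.Properties using (0↔⊥; 1↔⊤; +↔⊎; *↔×)
  open import Data.Fin.Permutation using (↔⇒≡)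
  open import Data.Product using (Σ; _,_)
  open import Data.Sum using (_⊎_; inj₁; inj₂)
  open import Data.Sum.Function.Propositional using (_⊎-↔_)
  open import Data.Product.Function.NonDependent.Propositional using (_×-↔_)
  open import Data.Empty using (⊥; ⊥-elim)
  open import Data.Unit using (⊤; tt)
  open import Function.Bundles using (mk↔ₛ′)
  open import Function.Properties.Inverse using (↔-sym; ↔-trans)
  open import Relation.Binary.PropositionalEquality

  -- The embedding ℕ → ℚ is a semiring homomorphism; it is computed on the
  -- normal form n/1, whose sums and products are those of the numerators.
  ℕtoℚ-integral : ∀ n → ℕtoℚ n ≡ mkℚ (+ n) 0 (Coprimality.sym (1-coprimeTo n))
  ℕtoℚ-integral n = normalize-coprime (Coprimality.sym (1-coprimeTo n))

  ℕtoℚ-+ : ∀ a b → ℕtoℚ (a Nat.+ b) ≡ ℕtoℚ a + ℕtoℚ b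
  ℕtoℚ-+ a b = sym (begin
    ℕtoℚ a + ℕtoℚ b                    ≡⟨ cong₂ _+_ (ℕtoℚ-integral a) (ℕtoℚ-integral b) ⟩
    (+ a ℤ.* + 1 ℤ.+ + b ℤ.* + 1) / 1  ≡⟨ cong (_/ 1) (cong₂ ℤ._+_ (*-identityʳ (+ a)) (*-identityʳ (+ b))) ⟩
    (+ a ℤ.+ + b) / 1                  ≡⟨ cong (_/ 1) (sym (pos-+ a b)) ⟩
    ℕtoℚ (a Nat.+ b)                   ∎)
    where open ≡-Reasoning

  ℕtoℚ-* : ∀ a b → ℕtoℚ (a Nat.* b) ≡ ℕtoℚ a * ℕtoℚ b
  ℕtoℚ-* a b = sym (begin
    ℕtoℚ a * ℕtoℚ b    ≡⟨ cong₂ _*_ (ℕtoℚ-integral a) (ℕtoℚ-integral b) ⟩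
    (+ a ℤ.* + b) / 1  ≡⟨ cong (_/ 1) (sym (pos-* a b)) ⟩
    ℕtoℚ (a Nat.* b)   ∎)
    where open ≡-Reasoning

  record HasSize (A : Set) (q : ℚ) : Set where
    constructor sized
    field
      {count}     : ℕ
      enumeration : Fin count ↔ A
      count≡      : ℕtoℚ count ≡ q

  size-unique : ∀ {A p q} → HasSize A p → HasSize A q → p ≡ q
  size-unique (sized e refl) (sized e′ refl) = cong ℕtoℚ (↔⇒≡ (↔-trans e (↔-sym e′)))

  size-resp : ∀ {A B q} → A ↔ B → HasSize A q → HasSize B q
  size-resp A↔B (sized e c) = sized (↔-trans e A↔B) c

  size-⊥ : HasSize ⊥ 0ℚ
  size-⊥ = sized 0↔⊥ refl

  size-⊤ : HasSize ⊤ 1ℚ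
  size-⊤ = sized 1↔⊤ refl

  size-⊎ : ∀ {A B p q} → HasSize A p → HasSize B q → HasSize (A ⊎ B) (p + q)
  size-⊎ (sized {a} e refl) (sized {b} e′ refl) = sized (↔-trans (+↔⊎ {a}) (e ⊎-↔ e′)) (ℕtoℚ-+ a b)

  size-× : ∀ {A B p q} → HasSize A p → HasSize B q → HasSize (A × B) (p * q)
  size-× (sized {a} e refl) (sized {b} e′ refl) = sized (↔-trans (*↔× {a}) (e ×-↔ e′)) (ℕtoℚ-* a b)

  size-≡ : ∀ m n → HasSize (n ≡ m) (δ m n)
  size-≡ zero    zero    = size-resp (mk↔ₛ′ (λ _ → refl) (λ _ → tt) (λ { refl → refl }) (λ _ → refl)) size-⊤
  size-≡ zero    (suc n) = size-resp (mk↔ₛ′ (λ ()) (λ ()) (λ ()) (λ ())) size-⊥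
  size-≡ (suc m) zero    = size-resp (mk↔ₛ′ (λ ()) (λ ()) (λ ()) (λ ())) size-⊥
  size-≡ (suc m) (suc n) = size-resp (mk↔ₛ′ (cong suc) suc-injective (λ { refl → refl }) (λ { refl → refl })) (size-≡ m n)

  Σ≤ : ℕ → (ℕ → Set) → Set
  Σ≤ n B = Σ ℕ λ k → k ≤ n × B k

  Σ≤-zero : ∀ (B : ℕ → Set) → Σ≤ 0 B ↔ B 0
  Σ≤-zero B = mk↔ₛ′ (λ { (.0 , z≤n , b) → b }) (λ b → 0 , z≤n , b) (λ _ → refl) (λ { (.0 , z≤n , b) → refl })

  Σ≤-suc : ∀ n (B : ℕ → Set) → Σ≤ (suc n) B ↔ (Σ≤ n B ⊎ B (suc n))
  Σ≤-suc n B = mk↔ₛ′ split join split-join join-split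
    where
    split′ : ∀ k → B k → k < suc n ⊎ k ≡ suc n → Σ≤ n B ⊎ B (suc n)
    split′ k b (inj₁ (s≤s k≤n)) = inj₁ (k , k≤n , b)
    split′ k b (inj₂ refl)      = inj₂ b

    split : Σ≤ (suc n) B → Σ≤ n B ⊎ B (suc n)
    split (k , k≤1+n , b) = split′ k b (m≤n⇒m<n∨m≡n k≤1+n)

    join : Σ≤ n B ⊎ B (suc n) → Σ≤ (suc n) B
    join (inj₁ (k , k≤n , b)) = k , m≤n⇒m≤1+n k≤n , b
    join (inj₂ b)             = suc n , ≤-refl , b

    split-join : ∀ y → split (join y) ≡ y
    split-join (inj₁ (k , k≤n , b)) with m≤n⇒m<n∨m≡n (m≤n⇒m≤1+n k≤n)
    ... | inj₁ (s≤s k≤n′) = cong (λ p → inj₁ (k , p , b)) (≤-irrelevant k≤n′ k≤n)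
    ... | inj₂ refl       = ⊥-elim (<-irrefl refl k≤n)
    split-join (inj₂ b) with m≤n⇒m<n∨m≡n (≤-refl {suc n})
    ... | inj₁ 1+n<1+n = ⊥-elim (<-irrefl refl 1+n<1+n)
    ... | inj₂ refl    = refl

    join-split : ∀ x → join (split x) ≡ x
    join-split (k , k≤1+n , b) with m≤n⇒m<n∨m≡n k≤1+n
    ... | inj₁ (s≤s _) = cong (λ p → k , p , b) (≤-irrelevant _ _)
    ... | inj₂ refl    = cong (λ p → k , p , b) (≤-irrelevant _ _)

  size-Σ≤ : ∀ n (B : ℕ → Set) (h : ℕ → ℚ) → (∀ k → k ≤ n → HasSize (B k) (h k)) → HasSize (Σ≤ n B) (sumTo n h)
  size-Σ≤ zero    B h s = size-resp (↔-sym (Σ≤-zero B)) (s 0 z≤n)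
  size-Σ≤ (suc n) B h s = size-resp (↔-sym (Σ≤-suc n B))
    (size-⊎ (size-Σ≤ n B h (λ k k≤n → s k (m≤n⇒m≤1+n k≤n))) (s (suc n) ≤-refl))

-- Types graded by (t-degree, x-degree) and their generating series.
module Weighted where

  open FiniteSize
  open import Data.Nat using (zero; suc; _∸_; _+_; z≤n)
  open import Data.Nat.Properties using (≤-trans; ≤-irrelevant; ≡-irrelevant; m≤m+n; m+n∸m≡n; m+[n∸m]≡n; +-mono-≤)
  open import Data.Product using (Σ; _,_; proj₂)
  open import Data.Sum using (_⊎_; inj₁; inj₂)
  open import Data.Unit using (⊤; tt)
  open import Data.Rational using (_*_)
  open import Function.Bundles using (Inverse; mk↔ₛ′)
  open import Function.Properties.Inverse using (↔-sym)
  open import Relation.Binary.PropositionalEquality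
  open Inverse using (to; from; strictlyInverseˡ; strictlyInverseʳ)

  record WType : Set₁ where
    field
      Carrier : Set
      tdeg    : Carrier → ℕ
      xdeg    : Carrier → ℕ
  open WType public

  Fib : WType → ℕ → ℕ → Set
  Fib W m r = Σ (Carrier W) λ c → tdeg W c ≡ m × xdeg W c ≡ r

  fib-≡ : ∀ W {m r} {c c′ : Carrier W} {p p′} → c ≡ c′ → _≡_ {A = Fib W m r} (c , p) (c′ , p′)
  fib-≡ W {p = p , q} {p′ , q′} refl = cong₂ (λ u v → _ , u , v) (≡-irrelevant p p′) (≡-irrelevant q q′)

  CountedBy : WType → PS → Set
  CountedBy W F = ∀ m r → HasSize (Fib W m r) (F m r)

  fib-↔ : ∀ V W (φ : Carrier V ↔ Carrier W)
    → (∀ c → tdeg W (to φ c) ≡ tdeg V c) → (∀ c → xdeg W (to φ c) ≡ xdeg V c)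
    → ∀ m r → Fib V m r ↔ Fib W m r
  fib-↔ V W φ φ-t φ-x m r = mk↔ₛ′
    (λ { (c , p , q) → to φ c , trans (φ-t c) p , trans (φ-x c) q })
    (λ { (c , p , q) → from φ c , trans (back-t c) p , trans (back-x c) q })
    (λ { (c , _) → fib-≡ W (strictlyInverseˡ φ c) })
    (λ { (c , _) → fib-≡ V (strictlyInverseʳ φ c) })
    where
    back-t : ∀ c → tdeg V (from φ c) ≡ tdeg W c
    back-t c = trans (sym (φ-t (from φ c))) (cong (tdeg W) (strictlyInverseˡ φ c))
    back-x : ∀ c → xdeg V (from φ c) ≡ xdeg W c
    back-x c = trans (sym (φ-x (from φ c))) (cong (xdeg W) (strictlyInverseˡ φ c))

  monomial : ℕ → ℕ → WType
  monomial a b = record { Carrier = ⊤ ; tdeg = λ _ → a ; xdeg = λ _ → b }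

  counted-monomial : ∀ a b → CountedBy (monomial a b) (λ m r → δ m a * δ r b)
  counted-monomial a b m r = size-resp unit-fib (size-× (size-≡ m a) (size-≡ r b))
    where
    unit-fib : (a ≡ m × b ≡ r) ↔ Fib (monomial a b) m r
    unit-fib = mk↔ₛ′ (tt ,_) proj₂ (λ _ → refl) (λ _ → refl)

  _⊕W_ : WType → WType → WType
  V ⊕W W = record
    { Carrier = Carrier V ⊎ Carrier W
    ; tdeg    = λ { (inj₁ c) → tdeg V c ; (inj₂ c) → tdeg W c }
    ; xdeg    = λ { (inj₁ c) → xdeg V c ; (inj₂ c) → xdeg W c } }

  counted-⊕ : ∀ {V W F G} → CountedBy V F → CountedBy W G → CountedBy (V ⊕W W) (F ⊕ G)
  counted-⊕ {V} {W} cV cW m r = size-resp fibres (size-⊎ (cV m r) (cW m r))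
    where
    fibres : (Fib V m r ⊎ Fib W m r) ↔ Fib (V ⊕W W) m r
    fibres = mk↔ₛ′
      (λ { (inj₁ (c , p)) → inj₁ c , p ; (inj₂ (c , p)) → inj₂ c , p })
      (λ { (inj₁ c , p) → inj₁ (c , p) ; (inj₂ c , p) → inj₂ (c , p) })
      (λ { (inj₁ _ , _) → refl ; (inj₂ _ , _) → refl })
      (λ { (inj₁ _) → refl ; (inj₂ _) → refl })

  _⊠_ : WType → WType → WType
  V ⊠ W = record
    { Carrier = Carrier V × Carrier W
    ; tdeg    = λ { (c , d) → tdeg V c + tdeg W d }
    ; xdeg    = λ { (c , d) → xdeg V c + xdeg W d } }

  ⊠-fib : ∀ V W m r → Fib (V ⊠ W) m r ↔ Σ≤ m (λ i → Σ≤ r (λ j → Fib V i j × Fib W (m ∸ i) (r ∸ j)))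
  ⊠-fib V W m r = mk↔ₛ′ split join split-join join-split
    where
    split : Fib (V ⊠ W) m r → Σ≤ m (λ i → Σ≤ r (λ j → Fib V i j × Fib W (m ∸ i) (r ∸ j)))
    split ((c , d) , p , q) =
      tdeg V c , subst (tdeg V c ≤_) p (m≤m+n _ _) , xdeg V c , subst (xdeg V c ≤_) q (m≤m+n _ _) ,
      (c , refl , refl) ,
      (d , trans (sym (m+n∸m≡n (tdeg V c) (tdeg W d))) (cong (_∸ tdeg V c) p)
         , trans (sym (m+n∸m≡n (xdeg V c) (xdeg W d))) (cong (_∸ xdeg V c) q))

    join : Σ≤ m (λ i → Σ≤ r (λ j → Fib V i j × Fib W (m ∸ i) (r ∸ j))) → Fib (V ⊠ W) m r
    join (i , i≤m , j , j≤r , (c , refl , refl) , (d , p , q)) =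
      (c , d) , trans (cong (tdeg V c +_) p) (m+[n∸m]≡n i≤m) , trans (cong (xdeg V c +_) q) (m+[n∸m]≡n j≤r)

    join-split : ∀ x → join (split x) ≡ x
    join-split ((c , d) , _) = fib-≡ (V ⊠ W) refl

    split-join : ∀ y → split (join y) ≡ y
    split-join (._ , i≤m , ._ , j≤r , (c , refl , refl) , (d , _)) =
      cong₃ (λ i≤m j≤r d′ → tdeg V c , i≤m , xdeg V c , j≤r , (c , refl , refl) , d′)
            (≤-irrelevant _ _) (≤-irrelevant _ _) (fib-≡ W refl)
      where
      cong₃ : ∀ {A B C D : Set} (f : A → B → C → D) {a a′ b b′ c c′} → a ≡ a′ → b ≡ b′ → c ≡ c′ → f a b c ≡ f a′ b′ c′
      cong₃ f refl refl refl = refl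

  counted-⊠ : ∀ {V W F G} → CountedBy V F → CountedBy W G → CountedBy (V ⊠ W) (F ⊗ G)
  counted-⊠ {V} {W} {F} {G} cV cW m r = size-resp (↔-sym (⊠-fib V W m r))
    (size-Σ≤ m _ _ λ i _ → size-Σ≤ r _ _ λ j _ → size-× (cV i j) (cW (m ∸ i) (r ∸ j)))

  _^W_ : WType → ℕ → WType
  W ^W zero  = monomial 0 0
  W ^W suc k = W ⊠ (W ^W k)

  counted-^ : ∀ {W F} k → CountedBy W F → CountedBy (W ^W k) (F ^S k)
  counted-^ zero    _  = counted-monomial 0 0
  counted-^ (suc k) cW = counted-⊠ cW (counted-^ k cW)

  Seq : WType → WType
  Seq W = record
    { Carrier = Σ ℕ λ k → Carrier (W ^W k)
    ; tdeg    = λ { (k , c) → tdeg (W ^W k) c }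
    ; xdeg    = λ { (k , c) → xdeg (W ^W k) c } }

  -- If every element of W has positive t-degree, a sequence of length k has
  -- t-degree ≥ k, so only k ≤ m + r contribute in degree (m, r): Seq W is
  -- counted by the geometric series  Σ_k F^k = (1 - F)⁻¹.
  counted-Seq : ∀ {W F} → (∀ c → 1 ≤ tdeg W c) → CountedBy W F → CountedBy (Seq W) (geom F)
  counted-Seq {W} {F} pos cW m r = size-resp (↔-sym bounded) (size-Σ≤ (m + r) _ _ (λ k _ → counted-^ k cW m r))
    where
    length≤tdeg : ∀ k c → k ≤ tdeg (W ^W k) c
    length≤tdeg zero    _       = z≤n
    length≤tdeg (suc k) (c , s) = +-mono-≤ (pos c) (length≤tdeg k s)

    bounded : Fib (Seq W) m r ↔ Σ≤ (m + r) (λ k → Fib (W ^W k) m r)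
    bounded = mk↔ₛ′
      (λ { ((k , s) , p , q) → k , ≤-trans (subst (k ≤_) p (length≤tdeg k s)) (m≤m+n m r) , s , p , q })
      (λ { (k , _ , s , p , q) → (k , s) , p , q })
      (λ { (k , _ , _) → cong (λ k≤ → k , k≤ , _) (≤-irrelevant _ _) })
      (λ _ → refl)

-- Stable trees as a graded type, and their decomposition at the root.
module StableTrees where

  open FiniteSize
  open Weighted
  open import Data.Nat using (zero; suc; _+_; z≤n; s≤s)
  open import Data.Nat.Properties using (+-assoc)
  open import Data.Nat.Tactic.RingSolver using (solve-∀)
  import Data.Integer as ℤ
  open import Data.Integer using (+_)
  open import Data.Integer.Properties using (+-injective; pos-+)
  open import Axiom.UniquenessOfIdentityProofs using (module Decidable⇒UIP)
  open import Data.Integer.Tactic.RingSolver using () renaming (solve-∀ to ℤ-solve-∀)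
  open import Data.List using (List; []; _∷_; length)
  open import Data.Product using (Σ; _,_; proj₁; proj₂)
  open import Data.Sum using (inj₁; inj₂)
  open import Data.Unit using (tt)
  open import Data.Empty using (⊥)
  open import Function.Bundles using (mk↔ₛ′)
  open import Relation.Binary.PropositionalEquality

  mutual
    dimN : Tree → ℕ
    dimN (node [])              = 0
    dimN (node (_ ∷ []))        = 0   -- such a root is not stable
    dimN (node (c₁ ∷ c₂ ∷ cs)) = dimN c₁ + dimN c₂ + dimL cs

    dimL : List Tree → ℕ
    dimL []       = 0
    dimL (c ∷ cs) = suc (dimN c) + dimL cs

  mutual
    leaves-dimN : ∀ T → Stable T → leaves T ≡ suc (dimN T + internal T)
    leaves-dimN (node [])                 _                    = refl
    leaves-dimN (node (_ ∷ []))           (s≤s () , _)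
    leaves-dimN (node (c₁ ∷ c₂ ∷ cs))    (_ , s₁ , s₂ , ss)
      rewrite leaves-dimN c₁ s₁ | leaves-dimN c₂ s₂ | leavesL-dimL cs ss =
      regroup (dimN c₁) (internal c₁) (dimN c₂) (internal c₂) (dimL cs) (internalL cs)
      where
      regroup : ∀ d₁ i₁ d₂ i₂ d i → suc (d₁ + i₁) + (suc (d₂ + i₂) + (d + i)) ≡ suc ((d₁ + d₂ + d) + suc (i₁ + (i₂ + i)))
      regroup = solve-∀

    leavesL-dimL : ∀ cs → StableL cs → leavesL cs ≡ dimL cs + internalL cs
    leavesL-dimL []       _        = refl
    leavesL-dimL (c ∷ cs) (s , ss) rewrite leaves-dimN c s | leavesL-dimL cs ss =
      regroup (dimN c) (internal c) (dimL cs) (internalL cs)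
      where
      regroup : ∀ d₁ i₁ d i → suc (d₁ + i₁) + (d + i) ≡ (suc d₁ + d) + (i₁ + i)
      regroup = solve-∀

  dim≡dimN : ∀ T → Stable T → dim T ≡ + dimN T
  dim≡dimN T s rewrite leaves-dimN T s | pos-+ 1 (dimN T + internal T) | pos-+ (dimN T) (internal T) =
    cancel (+ dimN T) (+ internal T)
    where
    cancel : ∀ d i → (+ 1 ℤ.+ (d ℤ.+ i)) ℤ.- i ℤ.- + 1 ≡ d
    cancel = ℤ-solve-∀

  STree : WType
  STree = record { Carrier = Σ Tree Stable ; tdeg = λ T → dimN (proj₁ T) ; xdeg = λ T → leaves (proj₁ T) }

  -- The recursive shape of a stable tree: either a leaf (x), or a root with
  -- two first subtrees followed by a sequence of further subtrees, each of
  -- which raises the dimension by one (t · tree).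
  Shape : WType
  Shape = ((STree ⊠ STree) ⊠ Seq (monomial 1 0 ⊠ STree)) ⊕W monomial 0 1

  marked : (cs : List Tree) → StableL cs → Carrier ((monomial 1 0 ⊠ STree) ^W length cs)
  marked []       _        = tt
  marked (c ∷ cs) (s , ss) = (tt , (c , s)) , marked cs ss

  unmarked : ∀ k → Carrier ((monomial 1 0 ⊠ STree) ^W k) → Σ (List Tree) StableL
  unmarked zero    _                      = [] , tt
  unmarked (suc k) ((_ , (c , s)) , rest) = c ∷ proj₁ (unmarked k rest) , s , proj₂ (unmarked k rest)

  unmarked-marked : ∀ cs ss → unmarked (length cs) (marked cs ss) ≡ (cs , ss)
  unmarked-marked []       _        = refl
  unmarked-marked (c ∷ cs) (s , ss) = cong (λ u → c ∷ proj₁ u , s , proj₂ u) (unmarked-marked cs ss)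

  marked-unmarked : ∀ k rest → let (cs , ss) = unmarked k rest in
    _≡_ {A = Carrier (Seq (monomial 1 0 ⊠ STree))} (length cs , marked cs ss) (k , rest)
  marked-unmarked zero    _                     = refl
  marked-unmarked (suc k) ((tt , (c , s)) , rest) = cong (λ u → suc (proj₁ u) , (tt , (c , s)) , proj₂ u) (marked-unmarked k rest)

  marked-tdeg : ∀ cs ss → tdeg (Seq (monomial 1 0 ⊠ STree)) (length cs , marked cs ss) ≡ dimL cs
  marked-tdeg []       _        = refl
  marked-tdeg (c ∷ cs) (s , ss) = cong (λ d → suc (dimN c) + d) (marked-tdeg cs ss)

  marked-xdeg : ∀ cs ss → xdeg (Seq (monomial 1 0 ⊠ STree)) (length cs , marked cs ss) ≡ leavesL cs
  marked-xdeg []       _        = refl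
  marked-xdeg (c ∷ cs) (s , ss) = cong (λ r → leaves c + r) (marked-xdeg cs ss)

  decompose : Carrier STree → Carrier Shape
  decompose (node []                , _)                  = inj₂ tt
  decompose (node (_ ∷ [])          , (s≤s () , _))
  decompose (node (c₁ ∷ c₂ ∷ cs)   , (_ , s₁ , s₂ , ss)) = inj₁ (((c₁ , s₁) , (c₂ , s₂)) , (length cs , marked cs ss))

  assemble : Carrier Shape → Carrier STree
  assemble (inj₂ _) = node [] , tt
  assemble (inj₁ (((c₁ , s₁) , (c₂ , s₂)) , (k , rest))) =
    node (c₁ ∷ c₂ ∷ proj₁ (unmarked k rest)) , s≤s (s≤s z≤n) , s₁ , s₂ , proj₂ (unmarked k rest)

  decomposition : Carrier STree ↔ Carrier Shape
  decomposition = mk↔ₛ′ decompose assemble decompose-assemble assemble-decompose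
    where
    decompose-assemble : ∀ y → decompose (assemble y) ≡ y
    decompose-assemble (inj₂ tt) = refl
    decompose-assemble (inj₁ (((c₁ , s₁) , (c₂ , s₂)) , (k , rest))) =
      cong (λ u → inj₁ (((c₁ , s₁) , (c₂ , s₂)) , u)) (marked-unmarked k rest)

    assemble-decompose : ∀ x → assemble (decompose x) ≡ x
    assemble-decompose (node []               , _)                         = refl
    assemble-decompose (node (_ ∷ [])         , (s≤s () , _))
    assemble-decompose (node (c₁ ∷ c₂ ∷ cs)  , (s≤s (s≤s z≤n) , s₁ , s₂ , ss)) =
      cong (λ u → node (c₁ ∷ c₂ ∷ proj₁ u) , s≤s (s≤s z≤n) , s₁ , s₂ , proj₂ u) (unmarked-marked cs ss)

  decompose-tdeg : ∀ T → tdeg Shape (decompose T) ≡ tdeg STree T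
  decompose-tdeg (node []               , _)                  = refl
  decompose-tdeg (node (_ ∷ [])         , (s≤s () , _))
  decompose-tdeg (node (c₁ ∷ c₂ ∷ cs)  , (_ , s₁ , s₂ , ss)) = cong (λ d → dimN c₁ + dimN c₂ + d) (marked-tdeg cs ss)

  decompose-xdeg : ∀ T → xdeg Shape (decompose T) ≡ xdeg STree T
  decompose-xdeg (node []               , _)                  = refl
  decompose-xdeg (node (_ ∷ [])         , (s≤s () , _))
  decompose-xdeg (node (c₁ ∷ c₂ ∷ cs)  , (_ , s₁ , s₂ , ss)) =
    trans (cong (λ r → leaves c₁ + leaves c₂ + r) (marked-xdeg cs ss)) (+-assoc (leaves c₁) (leaves c₂) (leavesL cs))

  StableRRT↔Fib : ∀ m r → StableRRT m r ↔ Fib STree m r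
  StableRRT↔Fib m r = mk↔ₛ′
    (λ { (T , s , l , d) → (T , s) , +-injective (trans (sym (dim≡dimN T s)) d) , l })
    (λ { ((T , s) , p , l) → T , s , l , trans (dim≡dimN T s) (cong +_ p) })
    (λ { ((T , s) , _) → fib-≡ STree refl })
    (λ { (T , s , l , d) → cong (λ d′ → T , s , l , d′) (Decidable⇒UIP.≡-irrelevant ℤ._≟_ _ _) })

  no-tree-without-leaves : ∀ m → Fib STree m 0 → ⊥
  no-tree-without-leaves m ((T , s) , _ , l) with trans (sym (leaves-dimN T s)) l
  ... | ()

module Existence (a : ℕ → ℕ → ℕ) (enumerate : ∀ m r → 1 ≤ r → Fin (a m r) ↔ StableRRT m r) where

  open PowerSeries
  open FiniteSize
  open Weighted
  open StableTrees
  open import Data.Nat using (zero; suc; z≤n; s≤s)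
  open import Data.Rational using (ℚ; 1ℚ; _+_; _*_)
  open import Data.Rational.Properties using (*-identityˡ; *-zeroˡ; *-zeroʳ)
  open import Data.Empty using (⊥; ⊥-elim)
  open import Function.Bundles using (mk↔ₛ′)
  open import Function.Properties.Inverse using (↔-sym; ↔-trans)
  open import Relation.Binary.PropositionalEquality

  -- f = genFun a is the generating series of stable trees: there are no
  -- trees without leaves, and a m r enumerates those with r ≥ 1 leaves.
  counted-trees : CountedBy STree (genFun a)
  counted-trees m zero    = size-resp no-trees size-⊥
    where
    no-trees : ⊥ ↔ Fib STree m 0
    no-trees = mk↔ₛ′ (λ ()) (no-tree-without-leaves m) (λ T → ⊥-elim (no-tree-without-leaves m T)) (λ ())
  counted-trees m (suc r) = sized (↔-trans (enumerate m (suc r) (s≤s z≤n)) (StableRRT↔Fib m (suc r))) refl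

  counted-shape : CountedBy Shape (Φ (genFun a))
  counted-shape = counted-⊕
    (counted-⊠ (counted-⊠ counted-trees counted-trees)
               (counted-Seq (λ _ → s≤s z≤n) (counted-⊠ (counted-monomial 1 0) counted-trees)))
    (counted-monomial 0 1)

  genFun-equation : genFun a ≈ Φ (genFun a)
  genFun-equation m r = size-unique (counted-trees m r)
    (size-resp (↔-sym (fib-↔ STree Shape decomposition decompose-tdeg decompose-xdeg m r)) (counted-shape m r))

  -- With f₀₀ = 0 the t⁰x¹-coefficient of the equation gives f₀₁ = 1.
  genFun-∂x : ∂x (genFun a) 0 0 ≡ 1ℚ
  genFun-∂x = begin
    1ℚ * f₀₁                                         ≡⟨ *-identityˡ f₀₁ ⟩
    f₀₁                                              ≡⟨ equation-at-01 (genFun a) genFun-equation ⟩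
    (genFun a 0 0 * f₀₁ + f₀₁ * genFun a 0 0) + 1ℚ   ≡⟨ cong₂ (λ u v → (u + v) + 1ℚ) (*-zeroˡ f₀₁) (*-zeroʳ f₀₁) ⟩
    1ℚ                                               ∎
    where
    open ≡-Reasoning
    f₀₁ : ℚ
    f₀₁ = genFun a 0 1

  genFun-solves : SatisfiesEqs (genFun a)
  genFun-solves = genFun-equation , genFun-∂x

theorem2p1 : (a : ℕ → ℕ → ℕ)
    → (∀ m r → 1 ≤ r → Fin (a m r) ↔ StableRRT m r)
    → SatisfiesEqs (genFun a) × (∀ g → SatisfiesEqs g → g ≈ genFun a)
theorem2p1 a enumerate = solves , λ g g-solves → Uniqueness.uniqueness g (genFun a) g-solves solves
  where
  solves : SatisfiesEqs (genFun a)
  solves = Existence.genFun-solves a enumerate
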